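{- Let $k\ge 2$ and let $\{x_j\}_{j=1}^k,\{y_j\}_{j=1}^k,\{w_j\}_{j=1}^k,\{z_j\}_{j=1}^k$ be finite sequences of non-negative integers such that $x_j+y_j=w_j+z_j=j$ and $\{x_j,y_j\}\neq\{w_j,z_j\}$ for every $2\leq j\leq k$. Then there exists a finite set $A\subset\mathbb{Z}^2$ satisfying $|x_jA-y_jA|>|w_jA-z_jA|$ for every $2\leq j\leq k$.
   Context: For a finite set $A\subset\mathbb{Z}^2$ and non-negative integers $s,d$, $sA-dA=\{u_1+\cdots+u_s-v_1-\cdots-v_d: u_i,v_j\in A\}$ (empty sums equal $0$). -}

module Defs where

open import Data.Nat using (ℕ; zero; suc)
open import Data.Integer using (ℤ; +_; _+_; _-_)
open import Data.Product using (_×_; _,_)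
open import Data.Product.Properties using (≡-dec)
open import Data.List using (List; []; _∷_; concatMap; length; map)
open import Data.List.Base using (deduplicate)
open import Data.Integer.Properties using () renaming (_≟_ to _≟ℤ_)
open import Relation.Binary.PropositionalEquality using (_≡_)
open import Relation.Nullary using (¬_; Dec)
open import Relation.Nullary.Decidable using (¬?)

Pt : Set
Pt = ℤ × ℤ

_⊕_ : Pt → Pt → Pt
(a , b) ⊕ (c , d) = (a + c , b + d)

_⊖_ : Pt → Pt → Pt
(a , b) ⊖ (c , d) = (a - c , b - d)

origin : Pt
origin = (+ 0 , + 0)

_≟Pt_ : (p q : Pt) → Dec (p ≡ q)
_≟Pt_ = ≡-dec _≟ℤ_ _≟ℤ_

-- A finite set A ⊂ ℤ² is represented by a list of its elements
-- (repetitions allowed; they do not affect any of the sets below).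

sumList : ℕ → List Pt → List Pt
sumList zero    A = origin ∷ []
sumList (suc s) A = concatMap (λ u → map (u ⊕_) (sumList s A)) A

sdList : ℕ → ℕ → List Pt → List Pt
sdList s d A = concatMap (λ p → map (p ⊖_) (sumList d A)) (sumList s A)

card : List Pt → ℕ
card xs = length (deduplicate _≟Pt_ xs)

sdCard : ℕ → ℕ → List Pt → ℕ
sdCard s d A = card (sdList s d A)

PairNeq : ℕ → ℕ → ℕ → ℕ → Set
PairNeq x y w z = ¬ ((x ≡ w × y ≡ z) Data.Sum.⊎ (x ≡ z × y ≡ w))
  where import Data.Sum

{-# OPTIONS --safe #-}
-- A set A′ = c − A turns sA − dA into a translate of sA + dA′, so everything happens in ℕ and ℕ², and
-- sizes multiply under products (embedded back into ℕ by (a , b) ↦ a + b M with M large).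
--
-- Fix a level j = x + y.  A large basis b gives U, which is (up to the points 0 and K = bʲ) an additive basis
-- of order x for the first x digits, and V, likewise of order y for the remaining y digits.  Then
-- |xU + yV| ≥ bʲ, whereas |wU + zV| = O(bʲ⁻¹) for every other splitting w + z = j.
--
-- U and K − V are the rows of height 1 and n − 1 of a set A ⊂ [0,n] × [0,K], where n = 4(j + 1); the rows
-- 0, n and j + 1, …, 3(j + 1) are full, and the others are empty.  At a level i = s + d > j every row of
-- sA + dA′ is full.  At level j the only exceptions are row j, a sum of j ones, equal to sU + dV, and its
-- mirror image.  So the gadget of level j separates (x , y) from (w , z) at that level and does not see the
-- splitting at the higher levels.  Going down from level k, a high power of the gadget of level j settles
-- level j without disturbing the levels already settled.
module Submission where

open import Defs
open import Data.Nat
open import Data.Product using (Σ; ∃; ∃₂; _×_; _,_; proj₁; proj₂)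
open import Data.List using
  (List; []; _∷_; _++_; map; length; upTo; filter; concatMap; cartesianProduct; cartesianProductWith; deduplicate)
open import Relation.Binary.PropositionalEquality

open import Algebra.Bundles using (module AbelianGroup)
open import Algebra.Structures using (IsCommutativeMonoid)
open import Data.Empty using (⊥)
import Data.Integer as ℤ
import Data.Integer.Properties as ℤ
open import Algebra.Properties.Group (AbelianGroup.group ℤ.+-0-abelianGroup) using (∙-cancelʳ)
open import Data.List.Extrema.Nat using (max; xs≤max)
open import Data.List.Membership.Propositional using (_∈_)
open import Data.List.Membership.Propositional.Properties
open import Data.List.Properties using (length-map; length-++; length-upTo; map-++; map-∘; map-cong; map-id)
open import Data.List.Relation.Binary.Subset.Propositional using (_⊆_)
open import Data.List.Relation.Unary.All as All using ([]; _∷_)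
open import Data.List.Relation.Unary.All.Properties using () renaming (map⁺ to All-map⁺)
open import Data.List.Relation.Unary.AllPairs using ([]; _∷_)
open import Data.List.Relation.Unary.Any using (here; there)
open import Data.List.Relation.Unary.Unique.DecPropositional.Properties using (deduplicate-!)
open import Data.List.Relation.Unary.Unique.Propositional using (Unique)
import Data.List.Relation.Unary.Unique.Propositional.Properties as Unique
open import Data.Nat.DivMod using
  (_/_; _%_; m≡m%n+[m/n]*n; m%n<n; m<n*o⇒m/o<n; [m+kn]%n≡m%n; m<n⇒m%n≡m)
open import Data.Nat.Properties
open import Data.Nat.Tactic.RingSolver using (solve-∀)
open import Data.Product.Properties using (≡-dec; ,-injectiveˡ; ,-injectiveʳ)
open import Data.Sum using (_⊎_; inj₁; inj₂)
open import Relation.Binary.Definitions using (DecidableEquality; tri<; tri≈; tri>)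
open import Relation.Binary.PropositionalEquality.Algebra using () renaming (isMagma to ≡-isMagma)
open import Relation.Nullary using (¬_; yes; no; contradiction)
open import Relation.Nullary.Decidable using (¬?; _×-dec_)

-- Cardinalities of lists

unique-length-≤ : ∀ {G : Set} {us vs : List G} → Unique us → us ⊆ vs → length us ≤ length vs
unique-length-≤ [] _ = z≤n
unique-length-≤ {us = u ∷ us} (u∉ ∷ uniq) us⊆vs with ps , qs , refl ← ∈-∃++ (us⊆vs (here refl)) = begin
  suc (length us)                ≤⟨ s≤s (unique-length-≤ uniq avoid) ⟩
  suc (length (ps ++ qs))        ≡⟨ cong suc (length-++ ps) ⟩
  suc (length ps + length qs)    ≡⟨ +-suc (length ps) (length qs) ⟨
  length ps + suc (length qs)    ≡⟨ length-++ ps ⟨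
  length (ps ++ u ∷ qs)          ∎
  where
  open ≤-Reasoning
  avoid : us ⊆ ps ++ qs
  avoid v∈us with ∈-++⁻ ps (us⊆vs (there v∈us))
  ... | inj₁ v∈ps         = ∈-++⁺ˡ v∈ps
  ... | inj₂ (here refl)  = contradiction refl (All.lookup u∉ v∈us)
  ... | inj₂ (there v∈qs) = ∈-++⁺ʳ ps v∈qs

length-cartesianProductWith : ∀ {A B C : Set} (f : A → B → C) xs ys →
  length (cartesianProductWith f xs ys) ≡ length xs * length ys
length-cartesianProductWith f []       ys = refl
length-cartesianProductWith f (x ∷ xs) ys = trans (length-++ (map (f x) ys))
  (cong₂ _+_ (length-map (f x) ys) (length-cartesianProductWith f xs ys))

module Size {G : Set} (_≟′_ : DecidableEquality G) where

  size : List G → ℕ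
  size xs = length (deduplicate _≟′_ xs)

  size-≤ : ∀ {xs vs} → xs ⊆ vs → size xs ≤ length vs
  size-≤ {xs} xs⊆vs = unique-length-≤ (deduplicate-! _≟′_ xs) λ u∈ → xs⊆vs (∈-deduplicate⁻ _≟′_ xs u∈)

  size-≥ : ∀ {us xs} → Unique us → us ⊆ xs → length us ≤ size xs
  size-≥ uniq us⊆xs = unique-length-≤ uniq λ u∈ → ∈-deduplicate⁺ _≟′_ (us⊆xs u∈)

  size≡ : ∀ {us xs} → Unique us → us ⊆ xs → xs ⊆ us → size xs ≡ length us
  size≡ uniq us⊆xs xs⊆us = ≤-antisym (size-≤ xs⊆us) (size-≥ uniq us⊆xs)

-- Injectivity is asked for only on the list itself, since `encode` separates points only while
-- their first coordinates stay below the base.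
map-unique : ∀ {G H : Set} (f : G → H) {us} → (∀ {u v} → u ∈ us → v ∈ us → f u ≡ f v → u ≡ v) →
  Unique us → Unique (map f us)
map-unique f inj []            = []
map-unique f inj (u∉ ∷ uniq) =
  All-map⁺ (All.tabulate λ v∈ fu≡fv → All.lookup u∉ v∈ (inj (here refl) (there v∈) fu≡fv))
  ∷ map-unique f (λ u∈ v∈ → inj (there u∈) (there v∈)) uniq

module _ {G H : Set} (_≟G_ : DecidableEquality G) (_≟H_ : DecidableEquality H) where
  open Size

  size-map : ∀ (f : G → H) {xs ys} → (∀ {u v} → u ∈ xs → v ∈ xs → f u ≡ f v → u ≡ v) →
    map f xs ⊆ ys → ys ⊆ map f xs → size _≟H_ ys ≡ size _≟G_ xs
  size-map f {xs} inj fxs⊆ys ys⊆fxs = trans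
    (size≡ _≟H_ (map-unique f (λ u∈ v∈ → inj (back u∈) (back v∈)) (deduplicate-! _≟G_ xs))
      (λ v∈ → fxs⊆ys (out v∈)) (λ v∈ → inn (ys⊆fxs v∈)))
    (length-map f (deduplicate _≟G_ xs))
    where
    back : deduplicate _≟G_ xs ⊆ xs
    back = ∈-deduplicate⁻ _≟G_ xs
    out : map f (deduplicate _≟G_ xs) ⊆ map f xs
    out v∈ with _ , u∈ , refl ← ∈-map⁻ f v∈ = ∈-map⁺ f (back u∈)
    inn : map f xs ⊆ map f (deduplicate _≟G_ xs)
    inn v∈ with _ , u∈ , refl ← ∈-map⁻ f v∈ = ∈-map⁺ f (∈-deduplicate⁺ _≟G_ u∈)

  size-cartesianProduct : ∀ _≟GH_ {zs} xs ys → zs ⊆ cartesianProduct xs ys → cartesianProduct xs ys ⊆ zs →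
    size _≟GH_ zs ≡ size _≟G_ xs * size _≟H_ ys
  size-cartesianProduct _≟GH_ {zs} xs ys zs⊆ ⊆zs = trans
    (size≡ _≟GH_ (Unique.cartesianProduct⁺ (deduplicate-! _≟G_ xs) (deduplicate-! _≟H_ ys)) into out)
    (length-cartesianProductWith _,_ (deduplicate _≟G_ xs) (deduplicate _≟H_ ys))
    where
    into : cartesianProduct (deduplicate _≟G_ xs) (deduplicate _≟H_ ys) ⊆ zs
    into p∈ with u∈ , v∈ ← ∈-cartesianProduct⁻ (deduplicate _≟G_ xs) (deduplicate _≟H_ ys) p∈ =
      ⊆zs (∈-cartesianProduct⁺ (∈-deduplicate⁻ _≟G_ xs u∈) (∈-deduplicate⁻ _≟H_ ys v∈))
    out : zs ⊆ cartesianProduct (deduplicate _≟G_ xs) (deduplicate _≟H_ ys)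
    out p∈ with u∈ , v∈ ← ∈-cartesianProduct⁻ xs ys (zs⊆ p∈) =
      ∈-cartesianProduct⁺ (∈-deduplicate⁺ _≟G_ u∈) (∈-deduplicate⁺ _≟H_ v∈)

-- Sums of mirrored pairs

module Sums {G : Set} {_∙_ : G → G → G} {ε : G} (isCommutativeMonoid : IsCommutativeMonoid _≡_ _∙_ ε) where
  open IsCommutativeMonoid isCommutativeMonoid using (assoc; comm; identityˡ; identityʳ)

  sumset : ℕ → List G → List G
  sumset zero    A = ε ∷ []
  sumset (suc s) A = cartesianProductWith _∙_ A (sumset s A)

  mixed : ℕ → ℕ → List G → List G → List G
  mixed s d A A′ = cartesianProductWith _∙_ (sumset s A) (sumset d A′)

  times : ℕ → G → G
  times zero    c = ε
  times (suc s) c = c ∙ times s c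

  interchange : ∀ a b c d → (a ∙ b) ∙ (c ∙ d) ≡ (a ∙ c) ∙ (b ∙ d)
  interchange a b c d = begin
    (a ∙ b) ∙ (c ∙ d)  ≡⟨ assoc a b (c ∙ d) ⟩
    a ∙ (b ∙ (c ∙ d))  ≡⟨ cong (a ∙_) (assoc b c d) ⟨
    a ∙ ((b ∙ c) ∙ d)  ≡⟨ cong (λ e → a ∙ (e ∙ d)) (comm b c) ⟩
    a ∙ ((c ∙ b) ∙ d)  ≡⟨ cong (a ∙_) (assoc c b d) ⟩
    a ∙ (c ∙ (b ∙ d))  ≡⟨ assoc a c (b ∙ d) ⟨
    (a ∙ c) ∙ (b ∙ d)  ∎
    where open ≡-Reasoning

  times-+ : ∀ s d c → times (s + d) c ≡ times s c ∙ times d c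
  times-+ zero    d c = sym (identityˡ _)
  times-+ (suc s) d c = trans (cong (c ∙_) (times-+ s d c)) (sym (assoc c (times s c) (times d c)))

  length-sumset : ∀ s A → length (sumset s A) ≡ length A ^ s
  length-sumset zero    A = refl
  length-sumset (suc s) A = trans (length-cartesianProductWith _∙_ A (sumset s A))
    (cong (length A *_) (length-sumset s A))

  sumset-mono : ∀ s {A B} → A ⊆ B → sumset s A ⊆ sumset s B
  sumset-mono zero    A⊆B u∈ = u∈
  sumset-mono (suc s) {A} A⊆B u∈ with _ , _ , a∈ , v∈ , refl ← ∈-cartesianProductWith⁻ _∙_ A (sumset s A) u∈ =
    ∈-cartesianProductWith⁺ _∙_ (A⊆B a∈) (sumset-mono s A⊆B v∈)

  ∈-sumset-1 : ∀ {a A} → a ∈ A → a ∈ sumset 1 A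
  ∈-sumset-1 {a} {A} a∈ = subst (_∈ sumset 1 A) (identityʳ a) (∈-cartesianProductWith⁺ _∙_ a∈ (here refl))

  sumset-+ : ∀ s t {A u v} → u ∈ sumset s A → v ∈ sumset t A → (u ∙ v) ∈ sumset (s + t) A
  sumset-+ zero    t {A} {v = v} (here refl) v∈ = subst (_∈ sumset t A) (sym (identityˡ v)) v∈
  sumset-+ (suc s) t {A} {v = v} u∈ v∈ with a , u′ , a∈ , u′∈ , refl ← ∈-cartesianProductWith⁻ _∙_ A (sumset s A) u∈ =
    subst (_∈ sumset (suc s + t) A) (sym (assoc a u′ v)) (∈-cartesianProductWith⁺ _∙_ a∈ (sumset-+ s t u′∈ v∈))

  -- A sum of elements common to `A` and `A′` can be cut after any number of summands. In this way
  -- points found once in sums of `skeleton` occur in every splitting of the same level.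
  sumset-split : ∀ s d {S A A′} → S ⊆ A → S ⊆ A′ → sumset (s + d) S ⊆ mixed s d A A′
  sumset-split zero    d {A = A} {A′} S⊆A S⊆A′ {u} u∈ =
    subst (_∈ mixed zero d A A′) (identityˡ u) (∈-cartesianProductWith⁺ _∙_ {xs = ε ∷ []} (here refl) (sumset-mono d S⊆A′ u∈))
  sumset-split (suc s) d {S} {A} {A′} S⊆A S⊆A′ u∈
    with a , u′ , a∈ , u′∈ , refl ← ∈-cartesianProductWith⁻ _∙_ S (sumset (s + d) S) u∈
    with p , q , p∈ , q∈ , refl ← ∈-cartesianProductWith⁻ _∙_ (sumset s A) (sumset d A′) (sumset-split s d S⊆A S⊆A′ u′∈) =
    subst (_∈ mixed (suc s) d A A′) (assoc a p q)
      (∈-cartesianProductWith⁺ _∙_ (∈-cartesianProductWith⁺ _∙_ (S⊆A a∈) p∈) q∈)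

  -- Expresses A′ = c - A without subtraction, so that it makes sense in ℕ and ℕ².
  record Mirror (c : G) (A A′ : List G) : Set where
    constructor mkMirror
    field
      to   : ∀ {a} → a ∈ A → ∃ λ a′ → a′ ∈ A′ × a ∙ a′ ≡ c
      from : ∀ {a′} → a′ ∈ A′ → ∃ λ a → a ∈ A × a ∙ a′ ≡ c

  Mirror-sym : ∀ {c A A′} → Mirror c A A′ → Mirror c A′ A
  Mirror-sym m = mkMirror
    (λ a′∈ → let a , a∈ , e = Mirror.from m a′∈ in a , a∈ , trans (comm _ _) e)
    (λ a∈ → let a′ , a′∈ , e = Mirror.to m a∈ in a′ , a′∈ , trans (comm _ _) e)

  sumset-mirror : ∀ s {c A A′} → Mirror c A A′ → ∀ {u} → u ∈ sumset s A →
    ∃ λ u′ → u′ ∈ sumset s A′ × u ∙ u′ ≡ times s c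
  sumset-mirror zero    m (here refl) = ε , here refl , identityˡ ε
  sumset-mirror (suc s) {A = A} m u∈
    with a , v , a∈ , v∈ , refl ← ∈-cartesianProductWith⁻ _∙_ A (sumset s A) u∈
    with a′ , a′∈ , aa′ ← Mirror.to m a∈ | v′ , v′∈ , vv′ ← sumset-mirror s m v∈ =
    a′ ∙ v′ , ∈-cartesianProductWith⁺ _∙_ a′∈ v′∈ , trans (interchange a v a′ v′) (cong₂ _∙_ aa′ vv′)

  -- Reflection turns summands from `A` into summands from `A′` and conversely, hence the exchange
  -- of `s` and `d`.
  mixed-mirror : ∀ s d {c A A′} → Mirror c A A′ → ∀ {u} → u ∈ mixed s d A A′ →
    ∃ λ u′ → u′ ∈ mixed d s A A′ × u ∙ u′ ≡ times (s + d) c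
  mixed-mirror s d {c} {A} {A′} m u∈
    with p , q , p∈ , q∈ , refl ← ∈-cartesianProductWith⁻ _∙_ (sumset s A) (sumset d A′) u∈
    with p′ , p′∈ , pp′ ← sumset-mirror s m p∈ | q′ , q′∈ , qq′ ← sumset-mirror d (Mirror-sym m) q∈ =
    q′ ∙ p′ , ∈-cartesianProductWith⁺ _∙_ q′∈ p′∈ , (begin
      (p ∙ q) ∙ (q′ ∙ p′)    ≡⟨ cong ((p ∙ q) ∙_) (comm q′ p′) ⟩
      (p ∙ q) ∙ (p′ ∙ q′)    ≡⟨ interchange p q p′ q′ ⟩
      (p ∙ p′) ∙ (q ∙ q′)    ≡⟨ cong₂ _∙_ pp′ qq′ ⟩
      times s c ∙ times d c  ≡⟨ times-+ s d c ⟨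
      times (s + d) c        ∎)
    where open ≡-Reasoning

  -- The neutral element in both lists keeps every level non-empty, so that sizes are positive
  -- factors in products.
  record Config : Set where
    field
      A A′   : List G
      centre : G
      mirror : Mirror centre A A′
      ε∈A    : ε ∈ A
      ε∈A′   : ε ∈ A′

  level : Config → ℕ → ℕ → List G
  level C s d = mixed s d (Config.A C) (Config.A′ C)

  ε∈sumset : ∀ s {A} → ε ∈ A → ε ∈ sumset s A
  ε∈sumset zero    _  = here refl
  ε∈sumset (suc s) {A} ε∈ = subst (_∈ sumset (suc s) A) (identityˡ ε) (∈-cartesianProductWith⁺ _∙_ ε∈ (ε∈sumset s ε∈))

  ε∈level : ∀ C s d → ε ∈ level C s d
  ε∈level C s d = subst (_∈ level C s d) (identityˡ ε)
    (∈-cartesianProductWith⁺ _∙_ (ε∈sumset s (Config.ε∈A C)) (ε∈sumset d (Config.ε∈A′ C)))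

map-cartesianProductWith : ∀ {A B C D E F : Set} {f : A → B → C} {g : D → E → F} {h : A → D} {k : B → E} {l : C → F} →
  (∀ a b → g (h a) (k b) ≡ l (f a b)) →
  ∀ xs ys → cartesianProductWith g (map h xs) (map k ys) ≡ map l (cartesianProductWith f xs ys)
map-cartesianProductWith                 eq []       ys = refl
map-cartesianProductWith {f = f} {l = l} eq (x ∷ xs) ys = trans
  (cong₂ _++_ (trans (sym (map-∘ ys)) (trans (map-cong (eq x) ys) (map-∘ ys))) (map-cartesianProductWith eq xs ys))
  (sym (map-++ l (map (f x) ys) (cartesianProductWith f xs ys)))

module Hom {G H : Set} {_∙_ : G → G → G} {_∘_ : H → H → H} {ε : G} {η : H}
  (M : IsCommutativeMonoid _≡_ _∙_ ε) (N : IsCommutativeMonoid _≡_ _∘_ η)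
  (f : G → H) (f-∙ : ∀ a b → f a ∘ f b ≡ f (a ∙ b)) (f-ε : f ε ≡ η) where
  private
    module M = Sums M
    module N = Sums N

  sumset-map : ∀ s A → N.sumset s (map f A) ≡ map f (M.sumset s A)
  sumset-map zero    A = cong (_∷ []) (sym f-ε)
  sumset-map (suc s) A = trans (cong (cartesianProductWith _∘_ (map f A)) (sumset-map s A))
    (map-cartesianProductWith f-∙ A (M.sumset s A))

  mixed-map : ∀ s d A A′ → N.mixed s d (map f A) (map f A′) ≡ map f (M.mixed s d A A′)
  mixed-map s d A A′ = trans (cong₂ (cartesianProductWith _∘_) (sumset-map s A) (sumset-map d A′))
    (map-cartesianProductWith f-∙ (M.sumset s A) (M.sumset d A′))

  map-Mirror : ∀ {c A A′} → M.Mirror c A A′ → N.Mirror (f c) (map f A) (map f A′)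
  map-Mirror {A = A} {A′} m = N.mkMirror to from
    where
    to : ∀ {a} → a ∈ map f A → ∃ λ a′ → a′ ∈ map f A′ × a ∘ a′ ≡ _
    to b∈ with a , a∈ , refl ← ∈-map⁻ f b∈ with a′ , a′∈ , e ← M.Mirror.to m a∈ =
      f a′ , ∈-map⁺ f a′∈ , trans (f-∙ a a′) (cong f e)
    from : ∀ {a′} → a′ ∈ map f A′ → ∃ λ a → a ∈ map f A × a ∘ a′ ≡ _
    from b∈ with a′ , a′∈ , refl ← ∈-map⁻ f b∈ with a , a∈ , e ← M.Mirror.from m a′∈ =
      f a , ∈-map⁺ f a∈ , trans (f-∙ a a′) (cong f e)

  map-Config : M.Config → N.Config
  map-Config C = record
    { A = map f A ; A′ = map f A′ ; centre = f centre ; mirror = map-Mirror mirror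
    ; ε∈A = subst (_∈ map f A) f-ε (∈-map⁺ f ε∈A) ; ε∈A′ = subst (_∈ map f A′) f-ε (∈-map⁺ f ε∈A′) }
    where open M.Config C

-- Products and powers

_+₂_ : ℕ × ℕ → ℕ × ℕ → ℕ × ℕ
(a , b) +₂ (c , d) = a + c , b + d

+₂-isCommutativeMonoid : IsCommutativeMonoid _≡_ _+₂_ (0 , 0)
+₂-isCommutativeMonoid = record
  { isMonoid = record
    { isSemigroup = record
      { isMagma = ≡-isMagma _+₂_
      ; assoc   = λ (a , b) (c , d) (e , f) → cong₂ _,_ (+-assoc a c e) (+-assoc b d f)
      }
    ; identity = (λ _ → refl) , λ (a , b) → cong₂ _,_ (+-identityʳ a) (+-identityʳ b)
    }
  ; comm = λ (a , b) (c , d) → cong₂ _,_ (+-comm a c) (+-comm b d)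
  }

_≟₂_ = ≡-dec _≟_ _≟_

module Line  = Sums +-0-isCommutativeMonoid
module Plane = Sums +₂-isCommutativeMonoid

size₁ : Line.Config → ℕ → ℕ → ℕ
size₁ C s d = Size.size _≟_ (Line.level C s d)

size₂ : Plane.Config → ℕ → ℕ → ℕ
size₂ C s d = Size.size _≟₂_ (Plane.level C s d)

module _ (M : ℕ) where
  encode : ℕ × ℕ → ℕ
  encode (a , b) = a + b * M

  encode-+ : ∀ p q → encode p + encode q ≡ encode (p +₂ q)
  encode-+ (a , b) (c , d) = lemma a b c d M
    where
    lemma : ∀ a b c d M → (a + b * M) + (c + d * M) ≡ (a + c) + (b + d) * M
    lemma = solve-∀

encode-injective : ∀ M .{{_ : NonZero M}} {p q} → proj₁ p < M → proj₁ q < M → encode M p ≡ encode M q → p ≡ q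
encode-injective M {a , b} {c , d} a<M c<M e = cong₂ _,_ a≡c
  (*-cancelʳ-≡ b d M (+-cancelˡ-≡ a (b * M) (d * M) (trans e (cong (_+ d * M) (sym a≡c)))))
  where
  open ≡-Reasoning
  a≡c : a ≡ c
  a≡c = begin
    a                ≡⟨ m<n⇒m%n≡m a<M ⟨
    a % M            ≡⟨ [m+kn]%n≡m%n a b M ⟨
    (a + b * M) % M  ≡⟨ cong (_% M) e ⟩
    (c + d * M) % M  ≡⟨ [m+kn]%n≡m%n c d M ⟩
    c % M            ≡⟨ m<n⇒m%n≡m c<M ⟩
    c                ∎

sumset-proj₁-≤ : ∀ {m A} → (∀ {p} → p ∈ A → proj₁ p ≤ m) → ∀ s {p} → p ∈ Plane.sumset s A → proj₁ p ≤ s * m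
sumset-proj₁-≤ A≤ zero (here refl) = z≤n
sumset-proj₁-≤ {A = A} A≤ (suc s) p∈ with _ , _ , a∈ , q∈ , refl ← ∈-cartesianProductWith⁻ _+₂_ A (Plane.sumset s A) p∈ =
  +-mono-≤ (A≤ a∈) (sumset-proj₁-≤ A≤ s q∈)

flatten : ∀ k (C : Plane.Config) → Σ Line.Config λ C′ → ∀ s d → s + d ≤ k → size₁ C′ s d ≡ size₂ C s d
flatten k C = H.map-Config C , λ s d s+d≤k →
  size-map _≟₂_ _≟_ (encode M)
    (λ p∈ q∈ → encode-injective M (small s d s+d≤k p∈) (small s d s+d≤k q∈))
    (subst (_ ∈_) (sym (H.mixed-map s d A A′)))
    (subst (_ ∈_) (H.mixed-map s d A A′))
  where
  open Plane.Config C
  m M : ℕ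
  m = max 0 (map proj₁ (A ++ A′))
  -- First coordinates of sums of at most k elements are at most k m, hence below this base.
  M = suc (k * m)
  module H = Hom +₂-isCommutativeMonoid +-0-isCommutativeMonoid (encode M) (encode-+ M) refl
  ≤m : ∀ {p} → p ∈ A ++ A′ → proj₁ p ≤ m
  ≤m p∈ = All.lookup (xs≤max 0 (map proj₁ (A ++ A′))) (∈-map⁺ proj₁ p∈)
  small : ∀ s d → s + d ≤ k → ∀ {p} → p ∈ Plane.level C s d → proj₁ p < M
  small s d s+d≤k p∈ with u , v , u∈ , v∈ , refl ← ∈-cartesianProductWith⁻ _+₂_ (Plane.sumset s A) (Plane.sumset d A′) p∈ =
    s≤s (begin
      proj₁ u + proj₁ v  ≤⟨ +-mono-≤ (sumset-proj₁-≤ (λ a∈ → ≤m (∈-++⁺ˡ a∈)) s u∈)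
                                     (sumset-proj₁-≤ (λ a∈ → ≤m (∈-++⁺ʳ A a∈)) d v∈) ⟩
      s * m + d * m      ≡⟨ *-distribʳ-+ m s d ⟨
      (s + d) * m        ≤⟨ *-monoˡ-≤ m s+d≤k ⟩
      k * m              ∎)
    where open ≤-Reasoning

-- Both sums have the same number of summands, so these can be paired one by one. This is why sizes
-- of levels multiply.
sumset-× : ∀ s A B {u v} → u ∈ Line.sumset s A → v ∈ Line.sumset s B → (u , v) ∈ Plane.sumset s (cartesianProduct A B)
sumset-× zero    A B (here refl) (here refl) = here refl
sumset-× (suc s) A B u∈ v∈
  with _ , _ , a∈ , u′∈ , refl ← ∈-cartesianProductWith⁻ _+_ A (Line.sumset s A) u∈
  with _ , _ , b∈ , v′∈ , refl ← ∈-cartesianProductWith⁻ _+_ B (Line.sumset s B) v∈ =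
  ∈-cartesianProductWith⁺ _+₂_ (∈-cartesianProduct⁺ a∈ b∈) (sumset-× s A B u′∈ v′∈)

sumset-×⁻ : ∀ s A B {u v} → (u , v) ∈ Plane.sumset s (cartesianProduct A B) → u ∈ Line.sumset s A × v ∈ Line.sumset s B
sumset-×⁻ zero    A B (here refl) = here refl , here refl
sumset-×⁻ (suc s) A B p∈
  with _ , _ , ab∈ , q∈ , refl ← ∈-cartesianProductWith⁻ _+₂_ (cartesianProduct A B) (Plane.sumset s (cartesianProduct A B)) p∈
  with a∈ , b∈ ← ∈-cartesianProduct⁻ A B ab∈ | u∈ , v∈ ← sumset-×⁻ s A B q∈ =
  ∈-cartesianProductWith⁺ _+_ a∈ u∈ , ∈-cartesianProductWith⁺ _+_ b∈ v∈

Mirror-× : ∀ {c c′ A A′ B B′} → Line.Mirror c A A′ → Line.Mirror c′ B B′ →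
  Plane.Mirror (c , c′) (cartesianProduct A B) (cartesianProduct A′ B′)
Mirror-× {A = A} {A′} {B} {B′} m m′ = Plane.mkMirror
  (λ p∈ → let a∈ , b∈ = ∈-cartesianProduct⁻ A B p∈
              _ , a′∈ , e = Line.Mirror.to m a∈
              _ , b′∈ , e′ = Line.Mirror.to m′ b∈
          in _ , ∈-cartesianProduct⁺ a′∈ b′∈ , cong₂ _,_ e e′)
  (λ p∈ → let a∈ , b∈ = ∈-cartesianProduct⁻ A′ B′ p∈
              _ , a′∈ , e = Line.Mirror.from m a∈
              _ , b′∈ , e′ = Line.Mirror.from m′ b∈
          in _ , ∈-cartesianProduct⁺ a′∈ b′∈ , cong₂ _,_ e e′)

product : (C D : Line.Config) → Plane.Config
product C D = record
  { mirror = Mirror-× C.mirror D.mirror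
  ; ε∈A = ∈-cartesianProduct⁺ C.ε∈A D.ε∈A
  ; ε∈A′ = ∈-cartesianProduct⁺ C.ε∈A′ D.ε∈A′ }
  where
  module C = Line.Config C
  module D = Line.Config D

size-product : ∀ C D s d → size₂ (product C D) s d ≡ size₁ C s d * size₁ D s d
size-product C D s d = size-cartesianProduct _≟_ _≟_ _≟₂_ (Line.level C s d) (Line.level D s d) into out
  where
  module C = Line.Config C
  module D = Line.Config D
  into : Plane.level (product C D) s d ⊆ cartesianProduct (Line.level C s d) (Line.level D s d)
  into p∈ with _ , _ , u∈ , v∈ , refl ← ∈-cartesianProductWith⁻ _+₂_
                 (Plane.sumset s (cartesianProduct C.A D.A)) (Plane.sumset d (cartesianProduct C.A′ D.A′)) p∈
    with u₁∈ , u₂∈ ← sumset-×⁻ s C.A D.A u∈ | v₁∈ , v₂∈ ← sumset-×⁻ d C.A′ D.A′ v∈ =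
    ∈-cartesianProduct⁺ (∈-cartesianProductWith⁺ _+_ u₁∈ v₁∈) (∈-cartesianProductWith⁺ _+_ u₂∈ v₂∈)
  out : cartesianProduct (Line.level C s d) (Line.level D s d) ⊆ Plane.level (product C D) s d
  out p∈ with p₁∈ , p₂∈ ← ∈-cartesianProduct⁻ (Line.level C s d) (Line.level D s d) p∈
    with _ , _ , u₁∈ , v₁∈ , refl ← ∈-cartesianProductWith⁻ _+_ (Line.sumset s C.A) (Line.sumset d C.A′) p₁∈
    with _ , _ , u₂∈ , v₂∈ , refl ← ∈-cartesianProductWith⁻ _+_ (Line.sumset s D.A) (Line.sumset d D.A′) p₂∈ =
    ∈-cartesianProductWith⁺ _+₂_ (sumset-× s C.A D.A u₁∈ u₂∈) (sumset-× d C.A′ D.A′ v₁∈ v₂∈)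

-- Each product is flattened at once, which brings it back to the line and allows the next factor.
multiply-power : ∀ k (C D : Line.Config) n →
  Σ Line.Config λ E → ∀ s d → s + d ≤ k → size₁ E s d ≡ size₁ C s d * size₁ D s d ^ n
multiply-power k C D zero    = C , λ s d _ → sym (*-identityʳ (size₁ C s d))
multiply-power k C D (suc n) with E , hE ← multiply-power k C D n with F , hF ← flatten k (product D E) =
  F , λ s d s+d≤k → begin
    size₁ F s d                                ≡⟨ hF s d s+d≤k ⟩
    size₂ (product D E) s d                    ≡⟨ size-product D E s d ⟩
    size₁ D s d * size₁ E s d                  ≡⟨ cong (size₁ D s d *_) (hE s d s+d≤k) ⟩
    size₁ D s d * (size₁ C s d * size₁ D s d ^ n) ≡⟨ lemma (size₁ D s d) (size₁ C s d) (size₁ D s d ^ n) ⟩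
    size₁ C s d * (size₁ D s d * size₁ D s d ^ n) ∎
  where
  open ≡-Reasoning
  lemma : ∀ a b c → a * (b * c) ≡ b * (a * c)
  lemma = solve-∀

size₁-positive : ∀ C s d → 1 ≤ size₁ C s d
size₁-positive C s d = Size.size-≥ _≟_ {us = 0 ∷ []} ([] ∷ []) λ where (here refl) → Line.ε∈level C s d

-- Bernoulli's inequality (1 + 1/b)ⁿ ≥ 1 + n/b with denominators cleared.
power-gap : ∀ b n → b ^ n * b + n * b ^ n ≤ suc b ^ n * b
power-gap b zero    = ≤-reflexive (+-identityʳ (b ^ 0 * b))
power-gap b (suc n) = begin
  b * b ^ n * b + suc n * (b * b ^ n)   ≤⟨ m≤m+n _ (n * b ^ n) ⟩
  b * b ^ n * b + suc n * (b * b ^ n) + n * b ^ n ≡⟨ lemma b (b ^ n) n ⟩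
  suc b * (b ^ n * b + n * b ^ n)       ≤⟨ *-monoʳ-≤ (suc b) (power-gap b n) ⟩
  suc b * (suc b ^ n * b)               ≡⟨ *-assoc (suc b) (suc b ^ n) b ⟨
  suc b * suc b ^ n * b                 ∎
  where
  open ≤-Reasoning
  lemma : ∀ b p n → b * p * b + suc n * (b * p) + n * p ≡ suc b * (p * b + n * p)
  lemma = solve-∀

-- A strict inequality between the gadget sizes `b` and `a`, amplified by a power, outweighs any
-- unfavourable sizes `c` and `e` of the other factor.
power-dominates : ∀ {a b c e} → 1 ≤ b → 1 ≤ e → b < a → c * b ^ (b * c) < e * a ^ (b * c)
power-dominates {a} {b} {c} {e} 1≤b 1≤e b<a = begin-strict
  c * B                <⟨ m<n+m (c * B) {B} (m^n>0 b n) ⟩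
  B + c * B            ≤⟨ *-cancelʳ-≤ (B + c * B) (suc b ^ n) b
                            (≤-trans (≤-reflexive (lemma b B c)) (power-gap b n)) ⟩
  suc b ^ n            ≤⟨ ^-monoˡ-≤ n b<a ⟩
  a ^ n                ≡⟨ *-identityˡ (a ^ n) ⟨
  1 * a ^ n            ≤⟨ *-monoˡ-≤ (a ^ n) 1≤e ⟩
  e * a ^ n            ∎
  where
  open ≤-Reasoning
  instance _ = >-nonZero 1≤b
  -- With this exponent the gain n/b in Bernoulli's inequality is exactly c, so (b + 1)ⁿ ≥ (1 + c)
  -- bⁿ.
  n = b * c
  B = b ^ n
  lemma : ∀ b p c → (p + c * p) * b ≡ p * b + b * c * p
  lemma = solve-∀

-- From mirrored pairs to difference sets in ℤ²

⌜_⌝ : ℕ → Pt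
⌜ a ⌝ = ℤ.+ a , ℤ.+ 0

concatMap-map : ∀ {A B C : Set} (f : A → B → C) xs ys → concatMap (λ x → map (f x) ys) xs ≡ cartesianProductWith f xs ys
concatMap-map f []       ys = refl
concatMap-map f (x ∷ xs) ys = cong (map (f x) ys ++_) (concatMap-map f xs ys)

sumList-⌜⌝ : ∀ s A → sumList s (map ⌜_⌝ A) ≡ map ⌜_⌝ (Line.sumset s A)
sumList-⌜⌝ zero    A = refl
sumList-⌜⌝ (suc s) A = begin
  concatMap (λ u → map (u ⊕_) (sumList s (map ⌜_⌝ A))) (map ⌜_⌝ A)
    ≡⟨ concatMap-map _⊕_ (map ⌜_⌝ A) (sumList s (map ⌜_⌝ A)) ⟩
  cartesianProductWith _⊕_ (map ⌜_⌝ A) (sumList s (map ⌜_⌝ A))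
    ≡⟨ cong (cartesianProductWith _⊕_ (map ⌜_⌝ A)) (sumList-⌜⌝ s A) ⟩
  cartesianProductWith _⊕_ (map ⌜_⌝ A) (map ⌜_⌝ (Line.sumset s A))
    ≡⟨ map-cartesianProductWith (λ _ _ → refl) A (Line.sumset s A) ⟩
  map ⌜_⌝ (Line.sumset (suc s) A) ∎
  where open ≡-Reasoning

sdList-⌜⌝ : ∀ s d A →
  sdList s d (map ⌜_⌝ A) ≡ cartesianProductWith (λ u v → ⌜ u ⌝ ⊖ ⌜ v ⌝) (Line.sumset s A) (Line.sumset d A)
sdList-⌜⌝ s d A = begin
  sdList s d (map ⌜_⌝ A)  ≡⟨ concatMap-map _⊖_ (sumList s (map ⌜_⌝ A)) (sumList d (map ⌜_⌝ A)) ⟩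
  cartesianProductWith _⊖_ (sumList s (map ⌜_⌝ A)) (sumList d (map ⌜_⌝ A))
    ≡⟨ cong₂ (cartesianProductWith _⊖_) (sumList-⌜⌝ s A) (sumList-⌜⌝ d A) ⟩
  cartesianProductWith _⊖_ (map ⌜_⌝ (Line.sumset s A)) (map ⌜_⌝ (Line.sumset d A))
    ≡⟨ map-cartesianProductWith {l = λ p → p} (λ _ _ → refl) (Line.sumset s A) (Line.sumset d A) ⟩
  map (λ p → p) (cartesianProductWith (λ u v → ⌜ u ⌝ ⊖ ⌜ v ⌝) (Line.sumset s A) (Line.sumset d A))
    ≡⟨ map-id _ ⟩
  cartesianProductWith (λ u v → ⌜ u ⌝ ⊖ ⌜ v ⌝) (Line.sumset s A) (Line.sumset d A) ∎
  where open ≡-Reasoning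

-- If v′ mirrors v, so that v + v′ = d · `centre`, then u - v = (u + v′) - d · `centre`. The
-- difference set is thus a translate of the level.
sdCard-⌜⌝ : ∀ C s d → sdCard s d (map ⌜_⌝ (Line.Config.A C)) ≡ size₁ C s d
sdCard-⌜⌝ C s d = trans (cong card (sdList-⌜⌝ s d A)) (size-map _≟_ _≟Pt_ shift
  (λ _ _ e → ℤ.+-injective (∙-cancelʳ (ℤ.- (ℤ.+ c)) _ _ (,-injectiveˡ e))) into out)
  where
  open Line.Config C
  c : ℕ
  c = Line.times d centre
  shift : ℕ → Pt
  shift m = ⌜ m ⌝ ⊖ ⌜ c ⌝
  shift-eq : ∀ u v v′ → v + v′ ≡ c → ⌜ u ⌝ ⊖ ⌜ v ⌝ ≡ shift (u + v′)
  shift-eq u v v′ e = cong (_, ℤ.+ 0) (begin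
    ℤ.+ u ℤ.- ℤ.+ v             ≡⟨ ℤ.[+m]-[+n]≡m⊖n u v ⟩
    u ℤ.⊖ v                   ≡⟨ ℤ.+-cancelˡ-⊖ v′ u v ⟨
    (v′ + u) ℤ.⊖ (v′ + v)     ≡⟨ cong₂ ℤ._⊖_ (+-comm v′ u) (trans (+-comm v′ v) e) ⟩
    (u + v′) ℤ.⊖ c            ≡⟨ ℤ.[+m]-[+n]≡m⊖n (u + v′) c ⟨
    ℤ.+ (u + v′) ℤ.- ℤ.+ c      ∎)
    where open ≡-Reasoning
  ds = cartesianProductWith (λ u v → ⌜ u ⌝ ⊖ ⌜ v ⌝) (Line.sumset s A) (Line.sumset d A)
  into : map shift (Line.level C s d) ⊆ ds
  into p∈ with _ , q∈ , refl ← ∈-map⁻ shift p∈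
    with u , v′ , u∈ , v′∈ , refl ← ∈-cartesianProductWith⁻ _+_ (Line.sumset s A) (Line.sumset d A′) q∈
    with v , v∈ , e ← Line.sumset-mirror d (Line.Mirror-sym mirror) v′∈ =
    subst (_∈ ds) (shift-eq u v v′ (trans (+-comm v v′) e)) (∈-cartesianProductWith⁺ _ u∈ v∈)
  out : ds ⊆ map shift (Line.level C s d)
  out p∈ with u , v , u∈ , v∈ , refl ← ∈-cartesianProductWith⁻ _ (Line.sumset s A) (Line.sumset d A) p∈
    with v′ , v′∈ , e ← Line.sumset-mirror d mirror v∈ =
    subst (_∈ map shift (Line.level C s d)) (sym (shift-eq u v v′ e))
      (∈-map⁺ shift (∈-cartesianProductWith⁺ _+_ u∈ v′∈))

-- The gadget of a single level

module Gadget (j K : ℕ) where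

  -- Here n = 4(j + 1), in a form for which `n ≡ suc n′` and `n ≡ N + 3 * N` both hold by
  -- computation.
  N n′ n : ℕ
  N  = suc j
  n′ = j + 3 * N
  n  = suc n′

  data Full : ℕ → Set where
    bottom : Full 0
    top    : Full n
    middle : ∀ {h} → N ≤ h → h ≤ 3 * N → Full h

  fullHeights : List ℕ
  fullHeights = 0 ∷ n ∷ filter (N ≤?_) (upTo (suc (3 * N)))

  data Row (U V : List ℕ) : ℕ × ℕ → Set where
    full : ∀ {h b} → Full h → b ≤ K → Row U V (h , b)
    low  : ∀ {b} → b ∈ U → Row U V (1 , b)
    high : ∀ {b} → b ∈ V → Row U V (n′ , K ∸ b)

  ∈-fullHeights⁺ : ∀ {h} → Full h → h ∈ fullHeights
  ∈-fullHeights⁺ bottom           = here refl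
  ∈-fullHeights⁺ top              = there (here refl)
  ∈-fullHeights⁺ (middle N≤h h≤) = there (there (∈-filter⁺ (N ≤?_) (∈-upTo⁺ (s≤s h≤)) N≤h))

  ∈-fullHeights⁻ : ∀ {h} → h ∈ fullHeights → Full h
  ∈-fullHeights⁻ (here refl)         = bottom
  ∈-fullHeights⁻ (there (here refl)) = top
  ∈-fullHeights⁻ (there (there h∈)) with h∈′ , N≤h ← ∈-filter⁻ (N ≤?_) h∈ = middle N≤h (s≤s⁻¹ (∈-upTo⁻ h∈′))

  -- Abstract, so that U and V can be inferred from gadget U V.
  abstract
    gadget : List ℕ → List ℕ → List (ℕ × ℕ)
    gadget U V = cartesianProduct fullHeights (upTo (suc K)) ++ map (1 ,_) U ++ map (λ b → n′ , K ∸ b) V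

    ∈-gadget⁺ : ∀ {U V p} → Row U V p → p ∈ gadget U V
    ∈-gadget⁺ (full h b≤K) = ∈-++⁺ˡ (∈-cartesianProduct⁺ (∈-fullHeights⁺ h) (∈-upTo⁺ (s≤s b≤K)))
    ∈-gadget⁺ (low b∈)     = ∈-++⁺ʳ (cartesianProduct fullHeights (upTo (suc K))) (∈-++⁺ˡ (∈-map⁺ _ b∈))
    ∈-gadget⁺ {U} (high b∈) = ∈-++⁺ʳ (cartesianProduct fullHeights (upTo (suc K))) (∈-++⁺ʳ (map (1 ,_) U) (∈-map⁺ _ b∈))

    ∈-gadget⁻ : ∀ {U V p} → p ∈ gadget U V → Row U V p
    ∈-gadget⁻ {U} {V} p∈ with ∈-++⁻ (cartesianProduct fullHeights (upTo (suc K))) p∈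
    ... | inj₁ q∈ with h∈ , b∈ ← ∈-cartesianProduct⁻ fullHeights (upTo (suc K)) q∈ =
      full (∈-fullHeights⁻ h∈) (s≤s⁻¹ (∈-upTo⁻ b∈))
    ... | inj₂ q∈ with ∈-++⁻ (map (1 ,_) U) q∈
    ... | inj₁ r∈ with _ , b∈ , refl ← ∈-map⁻ _ r∈ = low b∈
    ... | inj₂ r∈ with _ , b∈ , refl ← ∈-map⁻ _ r∈ = high b∈

  gadget-mono : ∀ {U V U′ V′} → U ⊆ U′ → V ⊆ V′ → gadget U V ⊆ gadget U′ V′
  gadget-mono U⊆ V⊆ p∈ with ∈-gadget⁻ p∈
  ... | full h b≤K = ∈-gadget⁺ (full h b≤K)
  ... | low b∈     = ∈-gadget⁺ (low (U⊆ b∈))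
  ... | high b∈    = ∈-gadget⁺ (high (V⊆ b∈))

  -- Full rows in sums of the skeleton

  ends : List ℕ
  ends = 0 ∷ K ∷ []

  -- Contained in both `gadget U V` and `gadget V U` as soon as `U` and `V` contain 0 and `K`; rows
  -- that it fills are therefore full whatever the splitting.
  skeleton : List (ℕ × ℕ)
  skeleton = gadget ends ends

  -- A weak form of fullness, asking only for the multiples of `K`. Rows 1 and `n′` of the skeleton
  -- satisfy it, and a single full summand then fills the gaps between the multiples.
  Corners : ℕ → ℕ → Set
  Corners i t = ∀ l → l ≤ i → (t , l * K) ∈ Plane.sumset i skeleton

  FullRow : ℕ → ℕ → Set
  FullRow i t = ∀ b → b ≤ i * K → (t , b) ∈ Plane.sumset i skeleton

  corners-0 : Corners 0 0
  corners-0 zero z≤n = here refl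

  corners-1 : ∀ {h} → (h , 0) ∈ skeleton → (h , K) ∈ skeleton → Corners 1 h
  corners-1 h0∈ hK∈ zero       _         = Plane.∈-sumset-1 h0∈
  corners-1 h0∈ hK∈ (suc zero) (s≤s z≤n) = subst (λ b → (_ , b) ∈ Plane.sumset 1 skeleton) (sym (+-identityʳ K))
    (Plane.∈-sumset-1 hK∈)

  corners-full : ∀ {h} → Full h → Corners 1 h
  corners-full h = corners-1 (∈-gadget⁺ (full h z≤n)) (∈-gadget⁺ (full h ≤-refl))

  corners-low : Corners 1 1
  corners-low = corners-1 (∈-gadget⁺ (low (here refl))) (∈-gadget⁺ (low (there (here refl))))

  corners-high : Corners 1 n′
  corners-high = corners-1
    (subst (λ b → (n′ , b) ∈ skeleton) (n∸n≡0 K) (∈-gadget⁺ (high (there (here refl)))))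
    (∈-gadget⁺ (high (here refl)))

  corners-+ : ∀ {i i′ t t′} → Corners i t → Corners i′ t′ → Corners (i + i′) (t + t′)
  corners-+ {i} {i′} {t} {t′} c c′ l l≤ = subst (λ b → (t + t′ , b) ∈ Plane.sumset (i + i′) skeleton)
    -- The first summand takes as many of the l copies of `K` as it can, the second takes the rest.
    (trans (sym (*-distribʳ-+ K (l ⊓ i) (l ∸ i))) (cong (_* K) (m⊓n+[m∸n]≡m l i)))
    (Plane.sumset-+ i i′ (c (l ⊓ i) (m⊓n≤n l i)) (c′ (l ∸ i) (m≤n+o⇒m∸n≤o l i l≤)))
    where
    m⊓n+[m∸n]≡m : ∀ m n → m ⊓ n + (m ∸ n) ≡ m
    m⊓n+[m∸n]≡m m n = trans (cong (_+ (m ∸ n)) (⊓-comm m n)) (m⊓n+n∸m≡n n m)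

  corners-* : ∀ {h} → Corners 1 h → ∀ i → Corners i (i * h)
  corners-* c zero    = corners-0
  corners-* c (suc i) = corners-+ c (corners-* c i)

  corners-pad : ∀ {i i′ t} → Corners i t → i ≤ i′ → Corners i′ t
  corners-pad {i} {i′} {t} c i≤i′ = subst₂ Corners (m+[n∸m]≡n i≤i′)
    (trans (cong (t +_) (*-zeroʳ (i′ ∸ i))) (+-identityʳ t))
    (corners-+ c (corners-* (corners-full bottom) (i′ ∸ i)))

  -- The remainder `c` may equal `K`, so that the extreme value b = (i + 1) K still has a quotient l
  -- ≤ i.
  slice : ∀ i b → b ≤ suc i * K → ∃₂ λ c l → c ≤ K × l ≤ i × b ≡ c + l * K
  slice i b b≤ with b ≤? K
  slice i       b b≤ | yes b≤K = b , 0 , b≤K , z≤n , sym (+-identityʳ b)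
  slice zero    b b≤ | no b≰K = contradiction (≤-trans b≤ (≤-reflexive (+-identityʳ K))) b≰K
  slice (suc i) b b≤ | no b≰K
    with c , l , c≤K , l≤i , e ← slice i (b ∸ K) (m≤n+o⇒m∸n≤o b K b≤) =
    c , suc l , c≤K , s≤s l≤i , (begin
      b                ≡⟨ m+[n∸m]≡n (≰⇒≥ b≰K) ⟨
      K + (b ∸ K)      ≡⟨ cong (K +_) e ⟩
      K + (c + l * K)  ≡⟨ lemma K c (l * K) ⟩
      c + suc l * K    ∎)
    where
    open ≡-Reasoning
    lemma : ∀ a b c → a + (b + c) ≡ b + (a + c)
    lemma = solve-∀

  fullRow : ∀ {f i t t′} → Full f → Corners i t → f + t ≡ t′ → FullRow (suc i) t′
  fullRow {f} {i} {t} h c refl b b≤ with c′ , l , c′≤K , l≤i , refl ← slice i b b≤ =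
    ∈-cartesianProductWith⁺ _+₂_ (∈-gadget⁺ (full h c′≤K)) (c l l≤i)

  -- r + q n is split into i + 1 heights, at least one of which is a full row.
  fullRow-divMod : ∀ i q r → r < n → r + q * n ≤ suc i * n →
    (r + q * n ≤ j → r + q * n < suc i) →
    (∀ r′ → r′ ≤ j → (r + q * n) + r′ ≡ suc i * n → r′ < suc i) →
    FullRow (suc i) (r + q * n)
  fullRow-divMod i q r r<n t≤ bot tp with suc i ≤? q
  ... | yes i<q = fullRow top (corners-* (corners-full top) i)
                    (≤-antisym (≤-trans (*-monoˡ-≤ n i<q) (m≤n+m (q * n) r)) t≤)
  ... | no i≮q with q≤i ← ≮⇒≥ i≮q | N ≤? r
  -- Row r ≤ j: one full bottom row, r rows of height 1, and further bottom rows as padding. The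
  -- hypothesis `bot` ensures that r ones leave room for the full row.
  fullRow-divMod i zero r r<n t≤ bot tp | no _ | no N≰r =
    fullRow bottom (corners-pad (corners-* corners-low r) (s≤s⁻¹ r<1+i))
      (trans (*-identityʳ r) (sym (+-identityʳ r)))
    where
    r<1+i : r < suc i
    r<1+i = subst (_< suc i) (+-identityʳ r) (bot (subst (_≤ j) (sym (+-identityʳ r)) (s≤s⁻¹ (≰⇒> N≰r))))
  -- One of the top rows, of height n = N + 3 N, is traded together with the remainder r for the two
  -- middle rows N + r and 3 N.
  fullRow-divMod (suc i) (suc q) r r<n t≤ bot tp | no i≮q | no N≰r =
    fullRow (middle (m≤m+n N r) (+-monoʳ-≤ N (≤-trans (<⇒≤ (≰⇒> N≰r)) (m≤m+n N (1 * N)))))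
      (corners-+ (corners-full (middle (m≤m+n N (2 * N)) ≤-refl))
        (corners-pad (corners-* (corners-full top) q) (s≤s⁻¹ (≮⇒≥ i≮q))))
      (lemma j r (q * n))
    where
    lemma : ∀ j r c → (suc j + r) + (3 * suc j + c) ≡ r + (suc (j + 3 * suc j) + c)
    lemma = solve-∀
  fullRow-divMod zero    (suc q) r r<n t≤ bot tp | no i≮q | no N≰r = contradiction (s≤s z≤n) i≮q
  fullRow-divMod i q r r<n t≤ bot tp | no i≮q | yes N≤r with r ≤? 3 * N
  ... | yes r≤3N = fullRow (middle N≤r r≤3N) (corners-pad (corners-* (corners-full top) q) (≮⇒≥ i≮q)) refl
  ... | no r≰3N with i ≤? q
  -- Mirror image of the bottom case: one full top row, r′ = n - r rows of height n - 1, and top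
  -- rows for the rest. Here `tp` leaves room for the full row.
  ... | yes i≤q = fullRow top
          (subst (λ i′ → Corners i′ (r′ * n′ + (i ∸ r′) * n)) (m+[n∸m]≡n r′≤i)
            (corners-+ (corners-* corners-high r′) (corners-* (corners-full top) (i ∸ r′))))
          (+-cancelʳ-≡ r′ _ _ (begin
            (n + (r′ * n′ + (i ∸ r′) * n)) + r′   ≡⟨ lemma n′ r′ (i ∸ r′) ⟩
            n + (r′ + (i ∸ r′)) * n               ≡⟨ cong (λ m → n + m * n) (m+[n∸m]≡n r′≤i) ⟩
            suc i * n                             ≡⟨ complement ⟨
            (r + q * n) + r′                      ∎))
    where
    open ≡-Reasoning
    r′ : ℕ
    r′ = n ∸ r
    q≡i : q ≡ i
    q≡i = ≤-antisym (≮⇒≥ i≮q) i≤q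
    complement : (r + q * n) + r′ ≡ suc i * n
    complement = trans (swap r (q * n) r′)
      (cong₂ (λ a b → a + b * n) (m+[n∸m]≡n (<⇒≤ r<n)) q≡i)
      where
      swap : ∀ a b c → (a + b) + c ≡ (a + c) + b
      swap = solve-∀
    r′≤j : r′ ≤ j
    r′≤j = m≤n+o⇒m∸n≤o n r (≤-trans (≤-reflexive (cong suc (+-comm j (3 * N)))) (+-monoˡ-≤ j (≰⇒> r≰3N)))
    r′≤i : r′ ≤ i
    r′≤i = s≤s⁻¹ (tp r′ r′≤j complement)
    lemma : ∀ a b c → (suc a + (b * a + c * suc a)) + b ≡ suc a + (b + c) * suc a
    lemma = solve-∀
  -- Now r > 3 N but a summand is to spare, so r is split into the middle heights r - 2 N and 2 N.
  fullRow-divMod (suc i) q r r<n t≤ bot tp | no i≮q | yes N≤r | no r≰3N | no i≰q =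
    fullRow (middle N≤r-2N r-2N≤3N)
      (corners-+ (corners-full (middle (m≤m+n N (1 * N)) (m≤n+m (2 * N) N)))
        (corners-pad (corners-* (corners-full top) q) (s≤s⁻¹ (≰⇒> i≰q))))
      (trans (sym (+-assoc (r ∸ 2 * N) (2 * N) (q * n))) (cong (_+ q * n) (m∸n+n≡m 2N≤r)))
    where
    2N≤r : 2 * N ≤ r
    2N≤r = ≤-trans (m≤n+m (2 * N) N) (<⇒≤ (≰⇒> r≰3N))
    N≤r-2N : N ≤ r ∸ 2 * N
    N≤r-2N = m+n≤o⇒m≤o∸n N (<⇒≤ (≰⇒> r≰3N))
    r-2N≤3N : r ∸ 2 * N ≤ 3 * N
    r-2N≤3N = m≤n+o⇒m∸n≤o r (2 * N) (≤-trans (<⇒≤ r<n) (+-monoˡ-≤ (3 * N) (m≤m+n N (1 * N))))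
  fullRow-divMod zero q r r<n t≤ bot tp | no i≮q | yes N≤r | no r≰3N | no i≰q = contradiction z≤n i≰q

  -- The last two hypotheses keep `t` away from the rows i, ..., j and their mirror images. They
  -- hold automatically when i > j; when i = j they exclude only row j and its mirror image.
  fullRow-≤ : ∀ i t → 1 ≤ i → t ≤ i * n → (t ≤ j → t < i) → (∀ r → r ≤ j → t + r ≡ i * n → r < i) → FullRow i t
  fullRow-≤ (suc i) t _ = subst
    (λ t → t ≤ suc i * n → (t ≤ j → t < suc i) → (∀ r → r ≤ j → t + r ≡ suc i * n → r < suc i) → FullRow (suc i) t)
    (sym (m≡m%n+[m/n]*n t n)) (fullRow-divMod i (t / n) (t % n) (m%n<n t n))

  -- Reflection of the gadget and the lowest rows

  Full-mirror : ∀ {h} → Full h → ∃ λ h′ → Full h′ × h + h′ ≡ n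
  Full-mirror bottom = n , top , refl
  Full-mirror top    = 0 , bottom , +-identityʳ n
  Full-mirror (middle {h} N≤h h≤3N) = n ∸ h
    , middle (m+n≤o⇒m≤o∸n N (+-monoʳ-≤ N h≤3N)) (m≤n+o⇒m∸n≤o n h (+-monoˡ-≤ (3 * N) N≤h))
    , m+[n∸m]≡n (≤-trans h≤3N (m≤n+m (3 * N) N))

  times-pair : ∀ s → Plane.times s (n , K) ≡ (s * n , s * K)
  times-pair zero    = refl
  times-pair (suc s) = cong ((n , K) +₂_) (times-pair s)

  -- A sum of height at most j can use only the heights 0 and 1, all others being at least `N`.
  -- Height s from s summands then forces every summand into row 1, that is, into `U`.
  bottomRow : ∀ {U V} s {p} → p ∈ Plane.sumset s (gadget U V) → proj₁ p ≤ j →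
    proj₁ p ≤ s × (proj₁ p ≡ s → proj₂ p ∈ Line.sumset s U)
  bottomRow zero (here refl) _ = z≤n , λ _ → here refl
  bottomRow {U} {V} (suc s) p∈ p≤j
    with a , q , a∈ , q∈ , refl ← ∈-cartesianProductWith⁻ _+₂_ (gadget U V) (Plane.sumset s (gadget U V)) p∈
    with q≤s , q≡s⇒ ← bottomRow s q∈ (≤-trans (m≤n+m (proj₁ q) (proj₁ a)) p≤j)
    with ∈-gadget⁻ a∈
  ... | full bottom _         = m≤n⇒m≤1+n q≤s , λ e → contradiction (≤-trans (≤-reflexive (sym e)) q≤s) 1+n≰n
  ... | full top _            = contradiction (≤-trans (m≤m+n N (3 * N)) (m+n≤o⇒m≤o n p≤j)) 1+n≰n
  ... | full (middle N≤h _) _ = contradiction (≤-trans N≤h (m+n≤o⇒m≤o _ p≤j)) 1+n≰n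
  ... | low b∈                = s≤s q≤s , λ e → ∈-cartesianProductWith⁺ _+_ b∈ (q≡s⇒ (suc-injective e))
  ... | high _                = contradiction
    (≤-trans (≤-trans (m≤m+n N (j + 2 * N)) (≤-reflexive (lemma j))) (m+n≤o⇒m≤o n′ p≤j)) 1+n≰n
    where
    lemma : ∀ j → suc j + (j + 2 * suc j) ≡ j + 3 * suc j
    lemma = solve-∀

  -- Since row `n′` holds the values K - b, reflection in (n , K) exchanges the roles of `U` and
  -- `V`; the bounds by `K` make the truncated subtraction exact.
  gadget-mirror : ∀ {U V} → (∀ {b} → b ∈ U → b ≤ K) → (∀ {b} → b ∈ V → b ≤ K) →
    ∀ {p} → p ∈ gadget U V → ∃ λ p′ → p′ ∈ gadget V U × p +₂ p′ ≡ (n , K)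
  gadget-mirror U≤K V≤K p∈ with ∈-gadget⁻ p∈
  ... | full {b = b} h b≤K with h′ , fh′ , e ← Full-mirror h =
    (h′ , K ∸ b) , ∈-gadget⁺ (full fh′ (m∸n≤m K b)) , cong₂ _,_ e (m+[n∸m]≡n b≤K)
  ... | low {b} b∈  = (n′ , K ∸ b) , ∈-gadget⁺ (high b∈) , cong (n ,_) (m+[n∸m]≡n (U≤K b∈))
  ... | high {b} b∈ = (1 , b) , ∈-gadget⁺ (low b∈) , cong₂ _,_ (+-comm n′ 1) (m∸n+n≡m (V≤K b∈))

  -- Sizes of the levels of a gadget

  module _ {U V : List ℕ} (U≤K : ∀ {b} → b ∈ U → b ≤ K) (V≤K : ∀ {b} → b ∈ V → b ≤ K)
    (ends⊆U : ends ⊆ U) (ends⊆V : ends ⊆ V) where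

    config : Plane.Config
    config = record
      { A = gadget U V ; A′ = gadget V U ; centre = n , K
      ; mirror = Plane.mkMirror (gadget-mirror U≤K V≤K)
          (λ {p} p∈ → let p′ , p′∈ , e = gadget-mirror V≤K U≤K p∈ in
            p′ , p′∈ , trans (cong₂ _,_ (+-comm (proj₁ p′) (proj₁ p)) (+-comm (proj₂ p′) (proj₂ p))) e)
      ; ε∈A = ∈-gadget⁺ (full bottom z≤n) ; ε∈A′ = ∈-gadget⁺ (full bottom z≤n) }

    skeleton⊆level : ∀ s d → Plane.sumset (s + d) skeleton ⊆ Plane.level config s d
    skeleton⊆level s d = Plane.sumset-split s d (gadget-mono ends⊆U ends⊆V) (gadget-mono ends⊆V ends⊆U)

    level-mirror : ∀ s d {t b} → (t , b) ∈ Plane.level config s d →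
      ∃₂ λ t′ b′ → (t′ , b′) ∈ Plane.level config d s × t + t′ ≡ (s + d) * n × b + b′ ≡ (s + d) * K
    level-mirror s d p∈ with (t′ , b′) , p′∈ , e ← Plane.mixed-mirror s d (Plane.Config.mirror config) p∈ =
      t′ , b′ , p′∈ , ,-injectiveˡ e′ , ,-injectiveʳ e′
      where e′ = trans e (times-pair (s + d))

    -- The two parts have heights at most s and d, and these add up to s + d, so both bounds are
    -- attained and `bottomRow` applies to each part.
    bottomRow-level : ∀ s d {t b} → (t , b) ∈ Plane.level config s d → t ≡ j → s + d ≡ j → b ∈ Line.mixed s d U V
    bottomRow-level s d p∈ t≡j refl
      with u , v , u∈ , v∈ , refl ← ∈-cartesianProductWith⁻ _+₂_ (Plane.sumset s (gadget U V)) (Plane.sumset d (gadget V U)) p∈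
      with u≤s , u≡s⇒ ← bottomRow s u∈ (≤-trans (m≤m+n (proj₁ u) (proj₁ v)) (≤-reflexive t≡j))
         | v≤d , v≡d⇒ ← bottomRow d v∈ (≤-trans (m≤n+m (proj₁ v) (proj₁ u)) (≤-reflexive t≡j)) =
      ∈-cartesianProductWith⁺ _+_
        (u≡s⇒ (≤-antisym u≤s (+-cancelʳ-≤ d s (proj₁ u) (≤-trans (≤-reflexive (sym t≡j)) (+-monoʳ-≤ (proj₁ u) v≤d)))))
        (v≡d⇒ (≤-antisym v≤d (+-cancelˡ-≤ s d (proj₁ v) (≤-trans (≤-reflexive (sym t≡j)) (+-monoˡ-≤ (proj₁ v) u≤s)))))

    -- The level is the whole grid: above level j no row is exceptional for `fullRow-≤`, and the
    -- mirror image of a point bounds its coordinates.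
    size-above : ∀ s d → j < s + d → size₂ config s d ≡ suc ((s + d) * n) * suc ((s + d) * K)
    size-above s d j<i = begin
      size₂ config s d
        ≡⟨ Size.size≡ _≟₂_ (Unique.cartesianProduct⁺ (Unique.upTo⁺ (suc (i * n))) (Unique.upTo⁺ (suc (i * K)))) into out ⟩
      length (cartesianProduct (upTo (suc (i * n))) (upTo (suc (i * K))))
        ≡⟨ length-cartesianProductWith _,_ (upTo (suc (i * n))) (upTo (suc (i * K))) ⟩
      length (upTo (suc (i * n))) * length (upTo (suc (i * K))) ≡⟨ cong₂ _*_ (length-upTo (suc (i * n))) (length-upTo (suc (i * K))) ⟩
      suc (i * n) * suc (i * K)                   ∎
      where
      open ≡-Reasoning
      i = s + d
      into : cartesianProduct (upTo (suc (i * n))) (upTo (suc (i * K))) ⊆ Plane.level config s d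
      into {t , b} p∈ with t∈ , b∈ ← ∈-cartesianProduct⁻ (upTo (suc (i * n))) (upTo (suc (i * K))) p∈ =
        skeleton⊆level s d (fullRow-≤ i t (≤-trans (s≤s z≤n) j<i) (s≤s⁻¹ (∈-upTo⁻ t∈))
          (λ t≤j → ≤-<-trans t≤j j<i) (λ _ r≤j _ → ≤-<-trans r≤j j<i) b (s≤s⁻¹ (∈-upTo⁻ b∈)))
      out : Plane.level config s d ⊆ cartesianProduct (upTo (suc (i * n))) (upTo (suc (i * K)))
      out p∈ with _ , _ , _ , et , eb ← level-mirror s d p∈ =
        ∈-cartesianProduct⁺ (∈-upTo⁺ (s≤s (m+n≤o⇒m≤o _ (≤-reflexive et)))) (∈-upTo⁺ (s≤s (m+n≤o⇒m≤o _ (≤-reflexive eb))))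

    module _ (1≤j : 1 ≤ j) where

      atHeight-j : ℕ → ℕ × ℕ
      atHeight-j b = j , b

      -- The second condition excludes the mirror row j n - j, written additively to avoid truncated
      -- subtraction.
      ordinary? = λ t → ¬? (t ≟ j) ×-dec ¬? (t + j ≟ j * n)

      ordinaryRows : List ℕ
      ordinaryRows = filter ordinary? (upTo (suc (j * n)))

      ordinary : List (ℕ × ℕ)
      ordinary = cartesianProduct ordinaryRows (upTo (suc (j * K)))

      -- Besides the ordinary rows only row j is counted; the mirror row can only add points.
      size-≥-at : ∀ s d {us} → s + d ≡ j → Unique us → us ⊆ Line.mixed s d U V →
        length ordinary + length us ≤ size₂ config s d
      size-≥-at s d {us} refl uniq us⊆ = ≤-trans
        (≤-reflexive (sym (trans (length-++ ordinary) (cong (length ordinary +_) (length-map atHeight-j us)))))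
        (Size.size-≥ _≟₂_ (Unique.++⁺
          (Unique.cartesianProduct⁺ (Unique.filter⁺ ordinary? (Unique.upTo⁺ (suc (j * n)))) (Unique.upTo⁺ (suc (j * K))))
          (Unique.map⁺ ,-injectiveʳ uniq) disjoint) into)
        where
        disjoint : ∀ {p} → p ∈ ordinary × p ∈ map atHeight-j us → ⊥
        disjoint (p∈ , q∈) with _ , _ , refl ← ∈-map⁻ atHeight-j q∈
          with t∈ , _ ← ∈-cartesianProduct⁻ ordinaryRows (upTo (suc (j * K))) p∈
          = proj₁ (proj₂ (∈-filter⁻ ordinary? {xs = upTo (suc (j * n))} t∈)) refl
        embed : ∀ s {U V u} → u ∈ Line.sumset s U → (s , u) ∈ Plane.sumset s (gadget U V)
        embed zero (here refl) = here refl
        embed (suc s) {U} u∈ with _ , _ , a∈ , v∈ , refl ← ∈-cartesianProductWith⁻ _+_ U (Line.sumset s U) u∈ =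
          ∈-cartesianProductWith⁺ _+₂_ (∈-gadget⁺ (low a∈)) (embed s v∈)
        into : ordinary ++ map atHeight-j us ⊆ Plane.level config s d
        into p∈ with ∈-++⁻ ordinary p∈
        into {t , b} p∈ | inj₁ q∈ with t∈ , b∈ ← ∈-cartesianProduct⁻ ordinaryRows (upTo (suc (j * K))) q∈
          with t∈′ , t≢j , t+j≢ ← ∈-filter⁻ ordinary? {xs = upTo (suc (j * n))} t∈ =
          skeleton⊆level s d (fullRow-≤ j t 1≤j (s≤s⁻¹ (∈-upTo⁻ t∈′)) (λ t≤j → ≤∧≢⇒< t≤j t≢j)
            (λ r r≤j e → ≤∧≢⇒< r≤j λ where refl → t+j≢ e) b (s≤s⁻¹ (∈-upTo⁻ b∈)))
        ... | inj₂ q∈ with _ , u∈ , refl ← ∈-map⁻ atHeight-j q∈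
          with _ , _ , v∈ , w∈ , refl ← ∈-cartesianProductWith⁻ _+_ (Line.sumset s U) (Line.sumset d V) (us⊆ u∈) =
          ∈-cartesianProductWith⁺ _+₂_ (embed s v∈) (embed d w∈)

      -- Both exceptional rows are charged: row j lies in sU + dV, and the mirror row is the
      -- reflection of row j of the splitting (d , s), which lies in dU + sV.
      size-≤-at : ∀ s d {us vs} → s + d ≡ j → Line.mixed s d U V ⊆ us → Line.mixed d s U V ⊆ vs →
        size₂ config s d ≤ length ordinary + (length us + length vs)
      size-≤-at s d {us} {vs} refl ⊆us ⊆vs = ≤-trans (Size.size-≤ _≟₂_ into) (≤-reflexive (begin
        length (ordinary ++ map atHeight-j us ++ map reflect vs)   ≡⟨ length-++ ordinary ⟩
        length ordinary + length (map atHeight-j us ++ map reflect vs) ≡⟨ cong (length ordinary +_) (length-++ (map atHeight-j us)) ⟩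
        length ordinary + (length (map atHeight-j us) + length (map reflect vs))
          ≡⟨ cong (length ordinary +_) (cong₂ _+_ (length-map atHeight-j us) (length-map reflect vs)) ⟩
        length ordinary + (length us + length vs) ∎))
        where
        open ≡-Reasoning
        reflect : ℕ → ℕ × ℕ
        reflect b = j * n ∸ j , j * K ∸ b
        into : Plane.level config s d ⊆ ordinary ++ map atHeight-j us ++ map reflect vs
        into {t , b} p∈ with t′ , b′ , p′∈ , et , eb ← level-mirror s d p∈ with t ≟ j | t + j ≟ j * n
        ... | yes t≡j | _ = ∈-++⁺ʳ ordinary (∈-++⁺ˡ (subst (λ t → (t , b) ∈ map atHeight-j us) (sym t≡j)
          (∈-map⁺ atHeight-j (⊆us (bottomRow-level s d p∈ t≡j refl)))))
        ... | no _ | yes t+j≡ = ∈-++⁺ʳ ordinary (∈-++⁺ʳ (map atHeight-j us) (subst (_∈ map reflect vs)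
          (cong₂ _,_ (trans (cong (_∸ j) (sym t+j≡)) (m+n∸n≡m t j)) (trans (cong (_∸ b′) (sym eb)) (m+n∸n≡m b b′)))
          (∈-map⁺ reflect (⊆vs (bottomRow-level d s p′∈ (+-cancelˡ-≡ t t′ j (trans et (sym t+j≡))) (+-comm d s))))))
        ... | no t≢j | no t+j≢ = ∈-++⁺ˡ (∈-cartesianProduct⁺
          (∈-filter⁺ ordinary? (∈-upTo⁺ (s≤s (m+n≤o⇒m≤o t (≤-reflexive et)))) (t≢j , t+j≢))
          (∈-upTo⁺ (s≤s (m+n≤o⇒m≤o b (≤-reflexive eb)))))

-- Digit sets

module Scale (c : ℕ) = Hom +-0-isCommutativeMonoid +-0-isCommutativeMonoid (c *_)
  (λ a b → sym (*-distribˡ-+ c a b)) (*-zeroʳ c)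

-- The numbers with at most one non-zero digit in base b, among the first m positions; a sum of m of
-- them can supply one digit for each position.
digits : ℕ → ℕ → List ℕ
digits b zero    = []
digits b (suc m) = upTo b ++ map (b *_) (digits b m)

length-digits : ∀ b m → length (digits b m) ≡ m * b
length-digits b zero    = refl
length-digits b (suc m) = trans (length-++ (upTo b))
  (cong₂ _+_ (length-upTo b) (trans (length-map (b *_) (digits b m)) (length-digits b m)))

digits-≤ : ∀ b .{{_ : NonZero b}} m {c} → c ∈ digits b m → c ≤ b ^ m
digits-≤ b (suc m) c∈ with ∈-++⁻ (upTo b) c∈
... | inj₁ c∈′ = ≤-trans (<⇒≤ (∈-upTo⁻ c∈′)) (m≤m*n b (b ^ m))
  where instance _ = m^n≢0 b m
... | inj₂ c∈′ with _ , e∈ , refl ← ∈-map⁻ (b *_) c∈′ = *-monoʳ-≤ b (digits-≤ b m e∈)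

digits-basis : ∀ b .{{_ : NonZero b}} m {a} → a < b ^ m → a ∈ Line.sumset m (digits b m)
digits-basis b zero    (s≤s z≤n) = here refl
digits-basis b (suc m) {a} a<    = subst (_∈ Line.sumset (suc m) (digits b (suc m)))
  (sym (trans (m≡m%n+[m/n]*n a b) (cong (a % b +_) (*-comm (a / b) b))))
  (∈-cartesianProductWith⁺ _+_ (∈-++⁺ˡ (∈-upTo⁺ (m%n<n a b)))
    (Line.sumset-mono m (∈-++⁺ʳ (upTo b))
      (subst (_ ∈_) (sym (Scale.sumset-map b m (digits b m)))
        (∈-map⁺ (b *_) (digits-basis b m (m<n*o⇒m/o<n (subst (a <_) (*-comm b (b ^ m)) a<)))))))

coarse : ℕ → ℕ → ℕ → List ℕ
coarse w q K = cartesianProductWith (λ e l → e + l * K) (upTo (suc (w * q))) (upTo (suc w))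

length-coarse : ∀ w q K → length (coarse w q K) ≡ suc (w * q) * suc w
length-coarse w q K = trans (length-cartesianProductWith _ (upTo (suc (w * q))) (upTo (suc w)))
  (cong₂ _*_ (length-upTo (suc (w * q))) (length-upTo (suc w)))

-- Here l counts the summands equal to `K`, and e is the sum of the others, each at most `q`.
sumset⊆coarse : ∀ w {q K Z} → (∀ {z} → z ∈ Z → z ≤ q ⊎ z ≡ K) → Line.sumset w Z ⊆ coarse w q K
sumset⊆coarse zero    Z-cases (here refl) = here refl
sumset⊆coarse (suc w) {q} {K} {Z} Z-cases u∈
  with z , v , z∈ , v∈ , refl ← ∈-cartesianProductWith⁻ _+_ Z (Line.sumset w Z) u∈
  with e , l , e∈ , l∈ , refl ← ∈-cartesianProductWith⁻ _ (upTo (suc (w * q))) (upTo (suc w)) (sumset⊆coarse w Z-cases v∈)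
  with Z-cases z∈
... | inj₁ z≤q = subst (_∈ coarse (suc w) q K) (+-assoc z e (l * K))
  (∈-cartesianProductWith⁺ _ (∈-upTo⁺ (s≤s (+-mono-≤ z≤q (s≤s⁻¹ (∈-upTo⁻ e∈))))) (∈-upTo⁺ (m≤n⇒m≤1+n (∈-upTo⁻ l∈))))
... | inj₂ refl = subst (_∈ coarse (suc w) q K) (lemma e K (l * K))
  (∈-cartesianProductWith⁺ _ (∈-upTo⁺ (s≤s (m≤n⇒m≤o+n q (s≤s⁻¹ (∈-upTo⁻ e∈))))) (∈-upTo⁺ (s≤s (∈-upTo⁻ l∈))))
  where
  lemma : ∀ a b c → a + (b + c) ≡ b + (a + c)
  lemma = solve-∀

^-distribʳ-* : ∀ n a b → (a * b) ^ n ≡ a ^ n * b ^ n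
^-distribʳ-* zero    a b = refl
^-distribʳ-* (suc n) a b = trans (cong (a * b *_) (^-distribʳ-* n a b)) (lemma a b (a ^ n) (b ^ n))
  where
  lemma : ∀ a b c d → a * b * (c * d) ≡ a * c * (b * d)
  lemma = solve-∀

-- Because w < x, the powers of b on the left multiply to at most b ^ (x + y), even with the extra
-- factor b. All remaining factors are bounded by powers of p = 2 + (x + y).
count-bound : ∀ b .{{_ : NonZero b}} {x y w z} → w < x → w + z ≡ x + y →
  b * ((2 + x * b) ^ w * (suc (z * b ^ y) * suc z)) ≤ (2 + (x + y)) ^ (2 + (x + y)) * b ^ (x + y)
count-bound b {x} {y} {w} {z} w<x e = begin
  b * ((2 + x * b) ^ w * (suc (z * b ^ y) * suc z))
    ≤⟨ *-monoʳ-≤ b (*-mono-≤ (^-monoˡ-≤ w 2+xb≤pb) (*-mono-≤ 1+zbʸ≤pbʸ 1+z≤p)) ⟩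
  b * ((p * b) ^ w * (p * b ^ y * p))      ≡⟨ cong (λ t → b * (t * (p * b ^ y * p))) (^-distribʳ-* w p b) ⟩
  b * (p ^ w * b ^ w * (p * b ^ y * p))    ≡⟨ lemma b p (p ^ w) (b ^ w) (b ^ y) ⟩
  p ^ (2 + w) * (b * (b ^ w * b ^ y))      ≡⟨ cong (λ t → p ^ (2 + w) * (b * t)) (^-distribˡ-+-* b w y) ⟨
  p ^ (2 + w) * b ^ (suc w + y)            ≤⟨ *-mono-≤ (^-monoʳ-≤ p (s≤s (s≤s w≤j))) (^-monoʳ-≤ b (+-monoˡ-≤ y w<x)) ⟩
  p ^ p * b ^ (x + y)                      ∎
  where
  open ≤-Reasoning
  p : ℕ
  p = 2 + (x + y)
  instance _ = m^n≢0 b y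
  w≤j : w ≤ x + y
  w≤j = ≤-trans (<⇒≤ w<x) (m≤m+n x y)
  1+z≤p : suc z ≤ p
  1+z≤p = m≤n⇒m≤1+n (s≤s (≤-trans (m≤n+m z w) (≤-reflexive e)))
  2+xb≤pb : 2 + x * b ≤ p * b
  2+xb≤pb = ≤-trans (+-monoˡ-≤ (x * b) (m≤m*n 2 b)) (≤-trans (≤-reflexive (sym (*-distribʳ-+ b 2 x)))
    (*-monoˡ-≤ b (+-monoʳ-≤ 2 (m≤m+n x y))))
  1+zbʸ≤pbʸ : suc (z * b ^ y) ≤ p * b ^ y
  1+zbʸ≤pbʸ = ≤-trans (+-monoˡ-≤ (z * b ^ y) (m^n>0 b y)) (*-monoˡ-≤ (b ^ y) 1+z≤p)
  lemma : ∀ b p P B C → b * (P * B * (p * C * p)) ≡ p * (p * P) * (b * (B * C))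
  lemma = solve-∀

module DigitSets (b : ℕ) .{{_ : NonZero b}} (x y : ℕ) where

  K : ℕ
  K = b ^ (x + y)

  -- `U` carries the x low digits and `V` the y high digits. The added elements 0, `K` and b ^ y,
  -- the last of which is scaled to `K`, provide the `ends` required by the gadget.
  U V₀ V : List ℕ
  U  = 0 ∷ K ∷ digits b x
  V₀ = 0 ∷ b ^ y ∷ digits b y
  V  = map (b ^ x *_) V₀

  U-cases : ∀ {u} → u ∈ U → u ≤ b ^ x ⊎ u ≡ K
  U-cases (here refl)         = inj₁ z≤n
  U-cases (there (here refl)) = inj₂ refl
  U-cases (there (there u∈))  = inj₁ (digits-≤ b x u∈)

  V₀-≤ : ∀ {v} → v ∈ V₀ → v ≤ b ^ y
  V₀-≤ (here refl)         = z≤n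
  V₀-≤ (there (here refl)) = ≤-refl
  V₀-≤ (there (there v∈))  = digits-≤ b y v∈

  U-≤ : ∀ {u} → u ∈ U → u ≤ K
  U-≤ u∈ with U-cases u∈
  ... | inj₁ u≤   = ≤-trans u≤ (^-monoʳ-≤ b (m≤m+n x y))
  ... | inj₂ refl = ≤-refl

  V-≤ : ∀ {v} → v ∈ V → v ≤ K
  V-≤ v∈ with v , v∈₀ , refl ← ∈-map⁻ (b ^ x *_) v∈ =
    ≤-trans (*-monoʳ-≤ (b ^ x) (V₀-≤ v∈₀)) (≤-reflexive (sym (^-distribˡ-+-* b x y)))

  ends⊆U : (0 ∷ K ∷ []) ⊆ U
  ends⊆U (here refl)         = here refl
  ends⊆U (there (here refl)) = there (here refl)

  ends⊆V : (0 ∷ K ∷ []) ⊆ V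
  ends⊆V (here refl)         = here (sym (*-zeroʳ (b ^ x)))
  ends⊆V (there (here refl)) = there (here (^-distribˡ-+-* b x y))

  length-U : length U ≡ 2 + x * b
  length-U = cong (2 +_) (length-digits b x)

  length-V : length V ≡ 2 + y * b
  length-V = trans (length-map (b ^ x *_) V₀) (cong (2 +_) (length-digits b y))

  sumset-V : ∀ z → Line.sumset z V ≡ map (b ^ x *_) (Line.sumset z V₀)
  sumset-V z = Scale.sumset-map (b ^ x) z V₀

  target : upTo K ⊆ Line.mixed x y U V
  target {a} a∈ = subst (_∈ Line.mixed x y U V)
    (sym (trans (m≡m%n+[m/n]*n a (b ^ x)) (cong (a % b ^ x +_) (*-comm (a / b ^ x) (b ^ x)))))
    (∈-cartesianProductWith⁺ _+_
      (Line.sumset-mono x (λ u∈ → there (there u∈)) (digits-basis b x (m%n<n a (b ^ x))))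
      (subst (_ ∈_) (sym (sumset-V y)) (∈-map⁺ (b ^ x *_)
        (Line.sumset-mono y (λ v∈ → there (there v∈)) (digits-basis b y (m<n*o⇒m/o<n a<))))))
    where
    instance _ = m^n≢0 b x
    a< : a < b ^ y * b ^ x
    a< = ≤-trans (∈-upTo⁻ a∈) (≤-reflexive (trans (^-distribˡ-+-* b x y) (*-comm (b ^ x) (b ^ y))))

  -- If w < x, then wU has O(bʷ) elements by counting tuples, while zV consists of multiples of bˣ
  -- and has O(bʸ). If w > x, then z < y and the roles are exchanged: wU clusters near multiples of
  -- `K` and has O(bˣ) elements, zV has O(bᶻ). Either way a factor b is lost.
  other : ∀ {w z} → w + z ≡ x + y → ¬ (w ≡ x × z ≡ y) →
    ∃ λ us → Line.mixed w z U V ⊆ us × b * length us ≤ (2 + (x + y)) ^ (2 + (x + y)) * b ^ (x + y)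
  other {w} {z} e ≢ with <-cmp w x
  ... | tri≈ _ refl _ = contradiction (refl , +-cancelˡ-≡ w z y e) ≢
  ... | tri< w<x _ _ = cartesianProductWith _+_ (Line.sumset w U) vs , into
    , ≤-trans (≤-reflexive (cong (b *_) len)) (count-bound b w<x e)
    where
    vs : List ℕ
    -- Taking q and K both equal to b ^ y in `coarse` costs only a factor z + 1 and gives the count
    -- the same shape as in the other case.
    vs = map (b ^ x *_) (coarse z (b ^ y) (b ^ y))
    into : Line.mixed w z U V ⊆ cartesianProductWith _+_ (Line.sumset w U) vs
    into p∈ with _ , v , u∈ , v∈ , refl ← ∈-cartesianProductWith⁻ _+_ (Line.sumset w U) (Line.sumset z V) p∈
      with _ , v₀∈ , refl ← ∈-map⁻ (b ^ x *_) (subst (v ∈_) (sumset-V z) v∈) =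
      ∈-cartesianProductWith⁺ _+_ u∈ (∈-map⁺ _ (sumset⊆coarse z (λ v∈ → inj₁ (V₀-≤ v∈)) v₀∈))
    len : length (cartesianProductWith _+_ (Line.sumset w U) vs) ≡ (2 + x * b) ^ w * (suc (z * b ^ y) * suc z)
    len = trans (length-cartesianProductWith _+_ (Line.sumset w U) vs) (cong₂ _*_
      (trans (Line.length-sumset w U) (cong (_^ w) length-U))
      (trans (length-map _ (coarse z (b ^ y) (b ^ y))) (length-coarse z (b ^ y) (b ^ y))))
  ... | tri> _ _ x<w = cartesianProductWith _+_ us (Line.sumset z V) , into
    , ≤-trans (≤-reflexive (cong (b *_) len))
        (≤-trans (count-bound b z<y (trans (+-comm z w) (trans e (+-comm x y))))
          (≤-reflexive (cong (λ j → (2 + j) ^ (2 + j) * b ^ j) (+-comm y x))))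
    where
    us : List ℕ
    us = coarse w (b ^ x) K
    z<y : z < y
    z<y = +-cancelˡ-< w z y (≤-trans (s≤s (≤-reflexive e)) (+-monoˡ-< y x<w))
    into : Line.mixed w z U V ⊆ cartesianProductWith _+_ us (Line.sumset z V)
    into p∈ with _ , _ , u∈ , v∈ , refl ← ∈-cartesianProductWith⁻ _+_ (Line.sumset w U) (Line.sumset z V) p∈ =
      ∈-cartesianProductWith⁺ _+_ (sumset⊆coarse w U-cases u∈) v∈
    len : length (cartesianProductWith _+_ us (Line.sumset z V)) ≡ (2 + y * b) ^ z * (suc (w * b ^ x) * suc w)
    len = trans (length-cartesianProductWith _+_ us (Line.sumset z V)) (trans (cong₂ _*_
      (length-coarse w (b ^ x) K)
      (trans (Line.length-sumset z V) (cong (_^ z) length-V))) (*-comm _ ((2 + y * b) ^ z)))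

-- Separating one level, then all levels

single-level : ∀ k {x y w z} → 1 ≤ x + y → x + y ≤ k → w + z ≡ x + y → PairNeq x y w z →
  Σ Line.Config λ C →
    (∀ s d s′ d′ → s + d ≡ s′ + d′ → x + y < s + d → s + d ≤ k → size₁ C s d ≡ size₁ C s′ d′) ×
    size₁ C w z < size₁ C x y
single-level k {x} {y} {w} {z} 1≤j j≤k w+z≡j x,y≢w,z = C , above , at
  where
  D b : ℕ
  D = (2 + (x + y)) ^ (2 + (x + y))
  -- By `other` each exceptional row of the losing splitting has at most D K / b points, so the two
  -- together have fewer than `K`.
  b = suc (D + D)
  open DigitSets b x y
  open Gadget (x + y) K
  C₂ : Plane.Config
  C₂ = config U-≤ V-≤ ends⊆U ends⊆V
  C : Line.Config
  C = proj₁ (flatten k C₂)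
  size-C : ∀ s d → s + d ≤ k → size₁ C s d ≡ size₂ C₂ s d
  size-C = proj₂ (flatten k C₂)
  above : ∀ s d s′ d′ → s + d ≡ s′ + d′ → x + y < s + d → s + d ≤ k → size₁ C s d ≡ size₁ C s′ d′
  above s d s′ d′ e j< ≤k = begin
    size₁ C s d    ≡⟨ size-C s d ≤k ⟩
    size₂ C₂ s d   ≡⟨ size-above U-≤ V-≤ ends⊆U ends⊆V s d j< ⟩
    suc ((s + d) * n) * suc ((s + d) * K)      ≡⟨ cong (λ i → suc (i * n) * suc (i * K)) e ⟩
    suc ((s′ + d′) * n) * suc ((s′ + d′) * K)  ≡⟨ size-above U-≤ V-≤ ends⊆U ends⊆V s′ d′ (subst (x + y <_) e j<) ⟨
    size₂ C₂ s′ d′ ≡⟨ size-C s′ d′ (subst (_≤ k) e ≤k) ⟨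
    size₁ C s′ d′  ∎
    where open ≡-Reasoning
  at : size₁ C w z < size₁ C x y
  -- The two halves of `PairNeq` serve the two exceptional rows: row j belongs to (w , z), the
  -- mirror row to (z , w), and neither may coincide with (x , y).
  at with us , ⊆us , us-short ← other w+z≡j (λ (w≡x , z≡y) → x,y≢w,z (inj₁ (sym w≡x , sym z≡y)))
        | vs , ⊆vs , vs-short ← other (trans (+-comm z w) w+z≡j) (λ (z≡x , w≡y) → x,y≢w,z (inj₂ (sym z≡x , sym w≡y))) = begin-strict
    size₁ C w z    ≡⟨ size-C w z (≤-trans (≤-reflexive w+z≡j) j≤k) ⟩
    size₂ C₂ w z   ≤⟨ size-≤-at U-≤ V-≤ ends⊆U ends⊆V 1≤j w z w+z≡j ⊆us ⊆vs ⟩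
    o + (length us + length vs)  <⟨ +-monoʳ-< o (*-cancelˡ-< b _ _ (begin-strict
      b * (length us + length vs)      ≡⟨ *-distribˡ-+ b (length us) (length vs) ⟩
      b * length us + b * length vs    ≤⟨ +-mono-≤ us-short vs-short ⟩
      D * K + D * K                    ≡⟨ *-distribʳ-+ K D D ⟨
      (D + D) * K                      <⟨ m<n+m ((D + D) * K) (m^n>0 b (x + y)) ⟩
      b * K                            ∎)) ⟩
    o + K          ≡⟨ cong (o +_) (length-upTo K) ⟨
    o + length (upTo K)  ≤⟨ size-≥-at U-≤ V-≤ ends⊆U ends⊆V 1≤j x y refl (Unique.upTo⁺ K) target ⟩
    size₂ C₂ x y   ≡⟨ size-C x y j≤k ⟨
    size₁ C x y    ∎
    where
    open ≤-Reasoning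
    o : ℕ
    o = length (ordinary U-≤ V-≤ ends⊆U ends⊆V 1≤j)

theorem3p1 : (k : ℕ) → 2 ≤ k → (x y w z : ℕ → ℕ)
    → (∀ j → 2 ≤ j → j ≤ k → x j + y j ≡ j)
    → (∀ j → 2 ≤ j → j ≤ k → w j + z j ≡ j)
    → (∀ j → 2 ≤ j → j ≤ k → PairNeq (x j) (y j) (w j) (z j))
    → Σ (List Pt) (λ A → ∀ j → 2 ≤ j → j ≤ k → sdCard (x j) (y j) A > sdCard (w j) (z j) A)
theorem3p1 k 2≤k x y w z x+y w+z x,y≢w,z = map ⌜_⌝ (Line.Config.A C) , λ j 2≤j j≤k →
  subst₂ _<_ (sym (sdCard-⌜⌝ C (w j) (z j))) (sym (sdCard-⌜⌝ C (x j) (y j))) (good j 2≤j j≤k)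
  where
  -- The starting point of the descent: nothing is demanded above level k.
  trivial : Line.Config
  trivial = record
    { A = 0 ∷ [] ; A′ = 0 ∷ [] ; centre = 0 ; ε∈A = here refl ; ε∈A′ = here refl
    ; mirror = Line.mkMirror (λ where (here refl) → 0 , here refl , refl) (λ where (here refl) → 0 , here refl , refl) }

  GoodAbove : ℕ → Line.Config → Set
  GoodAbove l C = ∀ j → l < j → j ≤ k → size₁ C (w j) (z j) < size₁ C (x j) (y j)

  extend : ∀ l → 1 ≤ l → suc l ≤ k → Σ Line.Config (GoodAbove (suc l)) → Σ Line.Config (GoodAbove l)
  extend l 1≤l ≤k (C , good) = E , good′
    where
    xy : x (suc l) + y (suc l) ≡ suc l
    xy = x+y (suc l) (s≤s 1≤l) ≤k
    gadget : Σ Line.Config λ D →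
      (∀ s d s′ d′ → s + d ≡ s′ + d′ → x (suc l) + y (suc l) < s + d → s + d ≤ k → size₁ D s d ≡ size₁ D s′ d′) ×
      size₁ D (w (suc l)) (z (suc l)) < size₁ D (x (suc l)) (y (suc l))
    gadget = single-level k (≤-trans (s≤s z≤n) (≤-reflexive (sym xy))) (≤-trans (≤-reflexive xy) ≤k)
      (trans (w+z (suc l) (s≤s 1≤l) ≤k) (sym xy)) (x,y≢w,z (suc l) (s≤s 1≤l) ≤k)
    D : Line.Config
    D = proj₁ gadget
    m : ℕ
    -- The exponent b c of `power-dominates`, with b and c the sizes of `D` and `C` at the losing
    -- splitting.
    m = size₁ D (w (suc l)) (z (suc l)) * size₁ C (w (suc l)) (z (suc l))
    E : Line.Config
    E = proj₁ (multiply-power k C D m)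
    size-E : ∀ s d → s + d ≤ k → size₁ E s d ≡ size₁ C s d * size₁ D s d ^ m
    size-E = proj₂ (multiply-power k C D m)
    good′ : GoodAbove l E
    good′ j l<j j≤k = subst₂ _<_
      (sym (size-E (w j) (z j) (≤-trans (≤-reflexive wz-j) j≤k)))
      (sym (size-E (x j) (y j) (≤-trans (≤-reflexive xy-j) j≤k)))
      (atLevel (m≤n⇒m<n∨m≡n l<j))
      where
      xy-j : x j + y j ≡ j
      xy-j = x+y j (≤-trans (s≤s 1≤l) l<j) j≤k
      wz-j : w j + z j ≡ j
      wz-j = w+z j (≤-trans (s≤s 1≤l) l<j) j≤k
      atLevel : suc l < j ⊎ suc l ≡ j →
        size₁ C (w j) (z j) * size₁ D (w j) (z j) ^ m < size₁ C (x j) (y j) * size₁ D (x j) (y j) ^ m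
      -- Above its own level the gadget has the same size for both splittings, so its power is a
      -- common positive factor.
      atLevel (inj₁ 1+l<j) = subst (λ t → size₁ C (w j) (z j) * t ^ m < size₁ C (x j) (y j) * size₁ D (x j) (y j) ^ m)
        (proj₁ (proj₂ gadget) (x j) (y j) (w j) (z j) (trans xy-j (sym wz-j)) (subst₂ _<_ (sym xy) (sym xy-j) 1+l<j)
          (≤-trans (≤-reflexive xy-j) j≤k))
        (*-monoˡ-< (size₁ D (x j) (y j) ^ m) (good j 1+l<j j≤k))
        where
        instance
          _ = >-nonZero (size₁-positive D (x j) (y j))
          _ = m^n≢0 (size₁ D (x j) (y j)) m
      atLevel (inj₂ refl) = power-dominates (size₁-positive D (w j) (z j)) (size₁-positive C (x j) (y j)) (proj₂ (proj₂ gadget))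

  levels : ∀ r l → l + r ≡ k → 1 ≤ l → Σ Line.Config (GoodAbove l)
  levels zero    l l+0≡k _   = trivial , λ j l<j j≤k →
    contradiction (≤-trans l<j (≤-trans j≤k (≤-reflexive (trans (sym l+0≡k) (+-identityʳ l))))) 1+n≰n
  levels (suc r) l l+r≡k 1≤l = extend l 1≤l (m+n≤o⇒m≤o (suc l) (≤-reflexive 1+l+r≡k)) (levels r (suc l) 1+l+r≡k (s≤s z≤n))
    where
    1+l+r≡k : suc l + r ≡ k
    1+l+r≡k = trans (sym (+-suc l r)) l+r≡k

  C : Line.Config
  -- The descent stops at l = 1, where `GoodAbove` covers exactly the levels 2 ≤ j ≤ k.
  C = proj₁ (levels (k ∸ 1) 1 (m+[n∸m]≡n (≤-trans (s≤s z≤n) 2≤k)) ≤-refl)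
  good : ∀ j → 2 ≤ j → j ≤ k → size₁ C (w j) (z j) < size₁ C (x j) (y j)
  good = proj₂ (levels (k ∸ 1) 1 (m+[n∸m]≡n (≤-trans (s≤s z≤n) 2≤k)) ≤-refl)
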